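{- Let $X\subseteq 2^\omega$. Then $X$ is an $SR^{\mathcal M}$ set if and only if every Borel image of $X$ (in $2^\omega$) is $\mathcal M$-additive and every Borel image of $X$ into $\omega^\omega$ is bounded.
   Context: $2^\omega$ is the Cantor space with coordinatewise addition modulo $2$, and $\mathcal M$ is the $\sigma$-ideal of meager subsets of $2^\omega$. For $H\subseteq 2^\omega\times 2^\omega$ and $x\in 2^\omega$ put $(H)_x=\{y:\langle x,y\rangle\in H\}$. An $\mathcal M$-set is a Borel set $H\subseteq 2^\omega\times 2^\omega$ with $(H)_x\in\mathcal M$ for all $x\in 2^\omega$. A set $X\subseteq 2^\omega$ is an $SR^{\mathcal M}$ set if $\bigcup_{x\in X}(H)_x\in\mathcal M$ for every $\mathcal M$-set $H$. A set $Y\subseteq 2^\omega$ is $\mathcal M$-additive if $Y+F\in\mathcal M$ for every $F\in\mathcal M$. A Borel image of $X$ in $2^\omega$ (respectively, into $\omega^\omega$) is a set $f[X]$ where $f$ is a Borel function from $X$ to $2^\omega$ (respectively, to $\omega^\omega$); equivalently, $f$ may be taken to be Borel on all of $2^\omega$. A set $F\subseteq\omega^\omega$ is bounded if there is $g\in\omega^\omega$ such that for every $f\in F$, $f(n)\le g(n)$ for all but finitely many $n$. -}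

module Defs where

open import Data.Bool.Base using (Bool; _xor_)
open import Data.Nat.Base using (ℕ; _≤_; _<_)
open import Data.Product.Base using (Σ; ∃; ∃₂; _×_; _,_; proj₁; proj₂)
open import Level using (Level; 0ℓ; _⊔_) renaming (suc to lsuc)
open import Relation.Binary.PropositionalEquality.Core using (_≡_)
open import Relation.Binary.PropositionalEquality using (_≗_)
open import Relation.Unary
  using (Pred; _∈_; _⊆_; _≐_; _≬_; _⊢_; ∁; ⋃; Empty)

-- A space is presented by its basic neighbourhoods: those of x are the sets
-- { y | x ≈[ n ] y }, n ∈ ℕ.  All spaces below are built from sequence spaces,
-- where x ≈[ n ] y means that x and y agree on their first n entries.

record Space : Set₁ where
  field
    Point  : Set
    _≈[_]_ : Point → ℕ → Point → Set

  Ball : Point → ℕ → Pred Point 0ℓ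
  Ball x n y = x ≈[ n ] y

open Space using (Point; Ball)

-- The product topology on A^ω, with A discrete.
Seq : Set → Space
Seq A = record
  { Point  = ℕ → A
  ; _≈[_]_ = λ x n y → ∀ i → i < n → x i ≡ y i
  }

infixr 2 _⊗_

_⊗_ : Space → Space → Space
S ⊗ T = record
  { Point  = Point S × Point T
  ; _≈[_]_ = λ (x , y) n (x′ , y′) → Ball S x n x′ × Ball T y n y′
  }

Subspace : (S : Space) → Pred (Point S) 0ℓ → Space
Subspace S X = record
  { Point  = Σ (Point S) X
  ; _≈[_]_ = λ x n y → Ball S (proj₁ x) n (proj₁ y)
  }

Cantor : Space
Cantor = Seq Bool

Baire : Space
Baire = Seq ℕ

2^ω : Set
2^ω = Point Cantor

ω^ω : Set
ω^ω = Point Baire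

module _ (S : Space) where

  Open : Pred (Point S) 0ℓ → Set
  Open U = ∀ {x} → x ∈ U → ∃ λ n → Ball S x n ⊆ U

  Interior : Pred (Point S) 0ℓ → Pred (Point S) 0ℓ
  Interior A x = ∃ λ n → Ball S x n ⊆ A

  Closure : Pred (Point S) 0ℓ → Pred (Point S) 0ℓ
  Closure A x = ∀ n → Ball S x n ≬ A

  NowhereDense : Pred (Point S) 0ℓ → Set
  NowhereDense A = Empty (Interior (Closure A))

  Meager : Pred (Point S) 0ℓ → Set₁
  Meager A = ∃ λ (N : ℕ → Pred (Point S) 0ℓ) →
    (∀ n → NowhereDense (N n)) × A ⊆ ⋃ ℕ N

-- The least σ-algebra containing 𝓖.  Sets are predicates, so membership in the
-- σ-algebra has to be closed explicitly under extensional equality of sets.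
data σ-algebra {A : Set} {ℓ : Level} (𝓖 : Pred A 0ℓ → Set ℓ) :
               Pred A 0ℓ → Set (lsuc 0ℓ ⊔ ℓ) where
  generator  : ∀ {P} → 𝓖 P → σ-algebra 𝓖 P
  complement : ∀ {P} → σ-algebra 𝓖 P → σ-algebra 𝓖 (∁ P)
  union      : ∀ {P : ℕ → Pred A 0ℓ} →
               (∀ n → σ-algebra 𝓖 (P n)) → σ-algebra 𝓖 (⋃ ℕ P)
  resp-≐     : ∀ {P Q} → P ≐ Q → σ-algebra 𝓖 P → σ-algebra 𝓖 Q

Borel : (S : Space) → Pred (Point S) 0ℓ → Set₁
Borel S = σ-algebra (Open S)

BorelFunction : (S T : Space) → (Point S → Point T) → Set₁
BorelFunction S T f = ∀ B → Borel T B → Borel S (f ⊢ B)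

-- Points of sequence spaces are compared by _≗_, since function extensionality
-- is not assumed.  Subsets X of 2^ω are arbitrary predicates, not required to
-- respect _≗_: every notion below depends only on the _≗_-closure of X.

Image : {P A : Set} → (P → ℕ → A) → Pred (ℕ → A) 0ℓ
Image f y = ∃ λ p → f p ≗ y

infixl 6 _⊞_ _⊕_

_⊞_ : 2^ω → 2^ω → 2^ω
(x ⊞ y) n = x n xor y n

_⊕_ : Pred 2^ω 0ℓ → Pred 2^ω 0ℓ → Pred 2^ω 0ℓ
(Y ⊕ F) z = ∃₂ λ y w → y ∈ Y × w ∈ F × y ⊞ w ≗ z

Section : Pred (2^ω × 2^ω) 0ℓ → 2^ω → Pred 2^ω 0ℓ
Section H x y = (x , y) ∈ H

𝓜-set : Pred (2^ω × 2^ω) 0ℓ → Set₁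
𝓜-set H = Borel (Cantor ⊗ Cantor) H × (∀ x → Meager Cantor (Section H x))

SR𝓜 : Pred 2^ω 0ℓ → Set₁
SR𝓜 X = ∀ H → 𝓜-set H →
  Meager Cantor (λ y → ∃ λ x → x ∈ X × y ∈ Section H x)

𝓜-additive : Pred 2^ω 0ℓ → Set₁
𝓜-additive Y = ∀ F → Meager Cantor F → Meager Cantor (Y ⊕ F)

Bounded : Pred ω^ω 0ℓ → Set
Bounded F = ∃ λ (g : ω^ω) → ∀ f → f ∈ F → ∃ λ m → ∀ n → m ≤ n → f n ≤ g n

module Submission where

-- A Borel set H in the plane agrees, off countably many dense open sets D j given by Borel
-- data, with a set U with open sections; if H has meager sections, U is empty.  For each n
-- there are N and a word w on [ n , N ) such that every y extending w there is in (D j)_x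
-- for all j ≤ n.  Boundedness of the Borel map sending x to the least such N (as a function
-- of n) yields one interval partition for all x ∈ X; concatenating the words gives a Borel
-- map z on X, and (H)_x ⊆ z x + F, where F is the meager set of those y that are nonzero on
-- almost all intervals.  Conversely, additivity is SR applied to { (x , y) | f x + y ∈ F },
-- and boundedness is SR applied to { (x , y) | y has a one in each [ i , i + max_{l ≤ i} f x l ] }:
-- an interval partition adapted to a meager set containing these sections must dominate f[X].

open import Defs
open import Axiom.ExcludedMiddle using (ExcludedMiddle)
open import Data.Bool.Base using (Bool; true; false; _xor_; if_then_else_)
open import Data.Bool.Properties using (¬-not; xor-assoc; xor-identityˡ; xor-same)
open import Data.Nat.Base using (ℕ; zero; suc; _+_; _⊔_; _≤_; _<_; z≤n; s≤s)
open import Data.Nat.Properties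
open import Data.Product.Base using (∃; _×_; _,_; proj₁; proj₂)
open import Data.Sum.Base using (_⊎_; inj₁; inj₂; [_,_]′)
open import Data.Unit.Base using (⊤; tt)
open import Function.Base using (id; _∘_)
open import Function.Bundles using (_⇔_; mk⇔; module Equivalence; _↠_; mk↠ₛ; module Surjection)
open import Level using (0ℓ; Lift; lift; lower) renaming (suc to lsuc)
open import Relation.Binary.Definitions using (tri<; tri≈; tri>)
open import Relation.Binary.PropositionalEquality using (_≡_; refl; sym; trans; cong; cong₂; subst; _≗_)
open import Relation.Nullary.Decidable using (Dec; yes; no; map′; decidable-stable)
open import Relation.Nullary.Negation using (¬_; contradiction)
open import Relation.Unary using (Pred; _∈_; _∉_; _⊆_; _⊢_; ∁)

open Space using (Point; Ball)

-- Enumerations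

-- Moves along an antidiagonal and, at its end, jumps to the start of the next one, so iterating it
-- from the origin visits every pair.
step : ℕ × ℕ → ℕ × ℕ
step (zero  , b) = suc b , zero
step (suc a , b) = a , suc b

unpair : ℕ → ℕ × ℕ
unpair zero    = zero , zero
unpair (suc n) = step (unpair n)

unpair-surjective : ∀ a b → ∃ λ n → unpair n ≡ (a , b)
unpair-surjective a b = onDiagonal (a + b) a b refl
  where
  onDiagonal : ∀ s a b → a + b ≡ s → ∃ λ n → unpair n ≡ (a , b)
  -- The recursion follows `step` backwards: to `(suc a , b)` on the same diagonal, or from
  -- `(suc a , 0)` to `(0 , a)` on the previous one.
  onDiagonal s a (suc b) eq with onDiagonal s (suc a) b (trans (sym (+-suc a b)) eq)
  ... | n , p = suc n , cong step p
  onDiagonal zero    zero    zero eq = zero , refl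
  onDiagonal (suc s) (suc a) zero eq
    with onDiagonal s zero a (suc-injective (trans (cong suc (sym (+-identityʳ a))) eq))
  ... | n , p = suc n , cong step p

ℕ↠Bool : ℕ ↠ Bool
ℕ↠Bool = mk↠ₛ {to = λ { zero → false ; (suc _) → true }} λ
  { false → 0 , refl ; true → 1 , refl }

ℕ↠ℕ : ℕ ↠ ℕ
ℕ↠ℕ = mk↠ₛ {to = id} λ n → n , refl

-- Repeated unpairing makes each code a total sequence, so no lengths have to be stored; every
-- finite word begins some `prefix e i`.
prefix : {A : Set} → ℕ ↠ A → ℕ → ℕ → A
prefix e i zero    = Surjection.to e (proj₁ (unpair i))
prefix e i (suc n) = prefix e (proj₂ (unpair i)) n

prefix-dense : {A : Set} (e : ℕ ↠ A) → ∀ n y → ∃ λ i → Ball (Seq A) y n (prefix e i)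
prefix-dense e zero    y = zero , λ _ ()
prefix-dense e (suc n) y =
  let a , ea≡y0    = Surjection.strictlySurjective e (y 0)
      i , agrees   = prefix-dense e n (y ∘ suc)
      c , unpair≡  = unpair-surjective a i
  in c , λ
    { zero    _         → sym (trans (cong (Surjection.to e ∘ proj₁) unpair≡) ea≡y0)
    ; (suc l) (s≤s l<n) → trans (agrees l l<n) (sym (cong (λ u → prefix e (proj₂ u) l) unpair≡)) }

-- Agreement on initial segments and intervals

module _ {A : Set} where

  private _≈[_]_ = λ y n y′ → Ball (Seq A) y n y′

  ≈-sym : ∀ {n y y′} → y ≈[ n ] y′ → y′ ≈[ n ] y
  ≈-sym p i i<n = sym (p i i<n)

  ≈-trans : ∀ {n x y z} → x ≈[ n ] y → y ≈[ n ] z → x ≈[ n ] z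
  ≈-trans p q i i<n = trans (p i i<n) (q i i<n)

  ≈-mono : ∀ {m n y y′} → m ≤ n → y ≈[ n ] y′ → y ≈[ m ] y′
  ≈-mono m≤n p i i<m = p i (<-≤-trans i<m m≤n)

  _≈⟨_,_⟩_ : (ℕ → A) → ℕ → ℕ → (ℕ → A) → Set
  y ≈⟨ a , b ⟩ y′ = ∀ i → a ≤ i → i < b → y i ≡ y′ i

-- Codes of dense open sets

-- A family E codes the set { y | ∃ n, E n y }.
record DenseOpen (E : ℕ → Pred 2^ω 0ℓ) : Set where
  field
    local : ∀ {n y y′} → Ball Cantor y n y′ → E n y → E n y′
    grow  : ∀ {n y} → E n y → E (suc n) y
    dense : ∀ y n → ∃ λ y′ → ∃ λ m → Ball Cantor y n y′ × E m y′

  grow-≤ : ∀ {m n y} → m ≤ n → E m y → E n y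
  grow-≤ {n = zero}  z≤n p = p
  grow-≤ {m} {suc n} m≤n p with m≤n⇒m<n∨m≡n m≤n
  ... | inj₁ (s≤s m≤n′) = grow (grow-≤ m≤n′ p)
  ... | inj₂ refl       = p

open DenseOpen

_∩ᵈ_ : (E E′ : ℕ → Pred 2^ω 0ℓ) → ℕ → Pred 2^ω 0ℓ
(E ∩ᵈ E′) n y = E n y × E′ n y

∩ᵈ-denseOpen : ∀ {E E′} → DenseOpen E → DenseOpen E′ → DenseOpen (E ∩ᵈ E′)
∩ᵈ-denseOpen d d′ = record
  { local = λ y≈y′ (p , p′) → local d y≈y′ p , local d′ y≈y′ p′
  ; grow  = λ (p , p′) → grow d p , grow d′ p′
  ; dense = λ y n →
      let y₁ , m₁ , y≈y₁  , p₁ = dense d y n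
          y₂ , m₂ , y₁≈y₂ , p₂ = dense d′ y₁ (n ⊔ m₁)
      in y₂ , m₁ ⊔ m₂
       , ≈-trans y≈y₁ (≈-mono (m≤m⊔n n m₁) y₁≈y₂)
       , grow-≤ d (m≤m⊔n m₁ m₂) (local d (≈-mono (m≤n⊔m n m₁) y₁≈y₂) p₁)
       , grow-≤ d′ (m≤n⊔m m₁ m₂) p₂
  }

⋂≤ : (ℕ → ℕ → Pred 2^ω 0ℓ) → ℕ → ℕ → Pred 2^ω 0ℓ
⋂≤ E zero    = E zero
⋂≤ E (suc k) = ⋂≤ E k ∩ᵈ E (suc k)

⋂≤-denseOpen : ∀ {E} → (∀ j → DenseOpen (E j)) → ∀ k → DenseOpen (⋂≤ E k)
⋂≤-denseOpen d zero    = d zero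
⋂≤-denseOpen d (suc k) = ∩ᵈ-denseOpen (⋂≤-denseOpen d k) (d (suc k))

⋂≤-elim : ∀ E {j k n y} → j ≤ k → ⋂≤ E k n y → E j n y
⋂≤-elim E {k = zero}  z≤n p = p
⋂≤-elim E {k = suc k} j≤k (p , q) with m≤n⇒m<n∨m≡n j≤k
... | inj₁ (s≤s j≤k′) = ⋂≤-elim E j≤k′ p
... | inj₂ refl       = q

infixr 5 _∷_

_∷_ : Bool → 2^ω → 2^ω
(b ∷ y) zero    = b
(b ∷ y) (suc i) = y i

∷-≈ : ∀ {n b y y′} → Ball Cantor y n y′ → Ball Cantor (b ∷ y) (suc n) (b ∷ y′)
∷-≈ p zero    _         = refl
∷-≈ p (suc i) (s≤s i<n) = p i i<n

tail-≈ : ∀ {n b y y′} → Ball Cantor (b ∷ y) (suc n) y′ → Ball Cantor y n (y′ ∘ suc)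
tail-≈ p i i<n = p (suc i) (s≤s i<n)

∷-tail : ∀ {n b} (y : 2^ω) → b ≡ y 0 → Ball Cantor (b ∷ y ∘ suc) n y
∷-tail y b≡y0 zero    _ = b≡y0
∷-tail y b≡y0 (suc i) _ = refl

slice : Bool → (ℕ → Pred 2^ω 0ℓ) → ℕ → Pred 2^ω 0ℓ
slice b E n y = E (suc n) (b ∷ y)

slice-denseOpen : ∀ {E} b → DenseOpen E → DenseOpen (slice b E)
slice-denseOpen b d = record
  { local = λ y≈y′ → local d (∷-≈ y≈y′)
  ; grow  = grow d
  ; dense = λ y n →
      let y′ , m , b∷y≈y′ , p = dense d (b ∷ y) (suc n)
      in y′ ∘ suc , m , tail-≈ b∷y≈y′
       , local d (≈-sym (∷-tail y′ (b∷y≈y′ 0 (s≤s z≤n)))) (grow d p)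
  }

-- A single block on [ n , N ) works for all 2ⁿ initial segments at once.
abstract
  steer : ∀ n {E} → DenseOpen E → ∃ λ N → ∃ λ w → ∀ y → w ≈⟨ n , N ⟩ y → E N y
  steer zero d =
    let w , N , _ , p = dense d (λ _ → false) zero
    in N , w , λ y w≈y → local d (λ i → w≈y i z≤n) p
  steer (suc n) {E} d =
    let N , w , steered = steer n (∩ᵈ-denseOpen (slice-denseOpen false d) (slice-denseOpen true d))
    -- The head `false` is a dummy, as index 0 lies below the block. The block forces the tail of
    -- `y` into both slices, and the first bit of `y` selects the one that applies.
    in suc N , false ∷ w , λ y w≈y → fromTail y (steered (y ∘ suc) λ i n≤i i<N → w≈y (suc i) (s≤s n≤i) (s≤s i<N))
    where
    fromTail : ∀ {N} y → (slice false E ∩ᵈ slice true E) N (y ∘ suc) → E (suc N) y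
    fromTail y (p , q) with y 0 in eq
    ... | false = local d (∷-tail y (sym eq)) p
    ... | true  = local d (∷-tail y (sym eq)) q

-- Interval partitions

module Partition (h : ℕ → ℕ → ℕ) where

  -- The maximum with `suc (endpoint k)` keeps every block nonempty whatever `h` demands; `h` sees
  -- the left endpoint, so a block can be as long as its starting position requires.
  endpoint : ℕ → ℕ
  endpoint zero    = zero
  endpoint (suc k) = suc (endpoint k) ⊔ h k (endpoint k)

  endpoint-< : ∀ k → endpoint k < endpoint (suc k)
  endpoint-< k = m≤m⊔n (suc (endpoint k)) (h k (endpoint k))

  h≤endpoint : ∀ k → h k (endpoint k) ≤ endpoint (suc k)
  h≤endpoint k = m≤n⊔m (suc (endpoint k)) (h k (endpoint k))

  endpoint-≤ : ∀ {k l} → k ≤ l → endpoint k ≤ endpoint l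
  endpoint-≤ {l = zero} z≤n = ≤-refl
  endpoint-≤ {k} {suc l} k≤l with m≤n⇒m<n∨m≡n k≤l
  ... | inj₁ (s≤s k≤l′) = ≤-trans (endpoint-≤ k≤l′) (<⇒≤ (endpoint-< l))
  ... | inj₂ refl       = ≤-refl

  k≤endpoint : ∀ k → k ≤ endpoint k
  k≤endpoint zero    = z≤n
  k≤endpoint (suc k) = ≤-<-trans (k≤endpoint k) (endpoint-< k)

  InBlock : ℕ → ℕ → Set
  InBlock k i = endpoint k ≤ i × i < endpoint (suc k)

  locate : ∀ i → ∃ λ k → InBlock k i
  locate zero    = zero , z≤n , ≤-<-trans z≤n (endpoint-< zero)
  locate (suc i) with locate i
  ... | k , b≤i , i<b′ with suc i <? endpoint (suc k)
  ...   | yes si<b′ = k , m≤n⇒m≤1+n b≤i , si<b′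
  ...   | no  si≮b′ = suc k , ≮⇒≥ si≮b′ , ≤-<-trans i<b′ (endpoint-< (suc k))

  block : ℕ → ℕ
  block = proj₁ ∘ locate

  block-unique : ∀ {k l i} → InBlock k i → InBlock l i → k ≡ l
  block-unique {k} {l} (bk≤i , i<bk′) (bl≤i , i<bl′) with <-cmp k l
  ... | tri< k<l _ _ = contradiction (≤-trans (endpoint-≤ k<l) bl≤i) (<⇒≱ i<bk′)
  ... | tri≈ _ k≡l _ = k≡l
  ... | tri> _ _ l<k = contradiction (≤-trans (endpoint-≤ l<k) bk≤i) (<⇒≱ i<bl′)

  glue : {A : Set} → (ℕ → ℕ → A) → ℕ → A
  glue w i = w (block i) i

  glue-≡ : ∀ {A : Set} (w : ℕ → ℕ → A) {k i} → InBlock k i → glue w i ≡ w k i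
  glue-≡ w {k} {i} inBlock = cong (λ l → w l i) (block-unique (proj₂ (locate i)) inBlock)

-- Steering into dense open sets and the Baire category theorem

module Steering {E : ℕ → ℕ → Pred 2^ω 0ℓ} (d : ∀ j → DenseOpen (E j)) where

  private
    target : ∀ k a → ∃ λ N → ∃ λ w → ∀ y → w ≈⟨ suc a , N ⟩ y → ⋂≤ E k N y
    target k a = steer (suc a) (⋂≤-denseOpen d k)

  open Partition (λ k a → proj₁ (target k a)) public

  word : ℕ → 2^ω
  word k = proj₁ (proj₂ (target k (endpoint k)))

  -- The left endpoint of the block stays free.
  word-steers : ∀ {j k y} → j ≤ k → word k ≈⟨ suc (endpoint k) , endpoint (suc k) ⟩ y →
                E j (endpoint (suc k)) y
  word-steers {j} {k} {y} j≤k w≈y = grow-≤ (d j) (h≤endpoint k)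
    (⋂≤-elim E j≤k (proj₂ (proj₂ (target k (endpoint k))) y
      λ i a≤i i<N → w≈y i a≤i (<-≤-trans i<N (h≤endpoint k))))

splice : ℕ → 2^ω → 2^ω → 2^ω
splice n y z i with i <? n
... | yes _ = y i
... | no  _ = z i

splice-< : ∀ n y z → Ball Cantor y n (splice n y z)
splice-< n y z i i<n with i <? n
... | yes _   = refl
... | no  i≮n = contradiction i<n i≮n

splice-≥ : ∀ {n} y z {i} → n ≤ i → splice n y z i ≡ z i
splice-≥ {n} y z {i} n≤i with i <? n
... | yes i<n = contradiction n≤i (<⇒≱ i<n)
... | no  _   = refl

-- Keep `y` below `n` and follow the steering words afterwards: any later block with index at least
-- `j` forces the point into `E j`.
baire-category : ∀ {E : ℕ → ℕ → Pred 2^ω 0ℓ} → (∀ j → DenseOpen (E j)) →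
                 ∀ y n → ∃ λ y′ → Ball Cantor y n y′ × (∀ j → ∃ λ m → E j m y′)
baire-category {E} d y n = y′ , splice-< n y (glue word) , meets
  where
  open Steering d

  y′ : 2^ω
  y′ = splice n y (glue word)

  meets : ∀ j → ∃ λ m → E j m y′
  meets j = endpoint (suc k) , word-steers {j} {k} (m≤m+n j n) λ i a≤i i<b →
    let bk≤i = ≤-trans (n≤1+n (endpoint k)) a≤i
        n≤i  = ≤-trans (m≤n+m n j) (≤-trans (k≤endpoint k) bk≤i)
    in sym (trans (splice-≥ y (glue word) n≤i) (glue-≡ word {k} (bk≤i , i<b)))
    where
    -- Being at least `j` lets the word of block `k` handle `E j`; being at least `n` puts the block
    -- beyond the part copied from `y`.
    k : ℕ
    k = j + n

-- Borel sets and Borel functions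

module _ {S : Space} where

  borel-const : (P : Set) → Borel S (λ _ → P)
  borel-const P = generator λ p → zero , λ _ → p

  borel-∃ : {I : Set} → ℕ ↠ I → {P : I → Pred (Point S) 0ℓ} →
            (∀ i → Borel S (P i)) → Borel S (λ x → ∃ λ i → P i x)
  borel-∃ e {P} b = resp-≐
    ( (λ (n , p) → to n , p)
    , (λ {x} (i , p) → let n , en≡i = strictlySurjective i in n , subst (λ i → P i x) (sym en≡i) p) )
    (union (b ∘ to))
    where open Surjection e

  borel-⊎ : ∀ {P Q} → Borel S P → Borel S Q → Borel S (λ x → P x ⊎ Q x)
  borel-⊎ {P} {Q} p q = resp-≐
    ( (λ { (false , r) → inj₁ r ; (true , r) → inj₂ r })
    , (λ { (inj₁ r) → false , r ; (inj₂ r) → true , r }) )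
    (borel-∃ ℕ↠Bool {λ b x → if b then Q x else P x} λ { false → p ; true → q })

  -- The quantifier over sequences is countable because only prefixes matter.
  borel-∃Seq : {A : Set} → ℕ ↠ A → ∀ n {P : (ℕ → A) → Pred (Point S) 0ℓ} →
               (∀ {y y′} → Ball (Seq A) y n y′ → P y ⊆ P y′) →
               (∀ y → Borel S (P y)) → Borel S (λ x → ∃ λ y → P y x)
  borel-∃Seq e n local b = resp-≐
    ( (λ (i , p) → prefix e i , p)
    , (λ (y , p) → let i , y≈ = prefix-dense e n y in i , local y≈ p) )
    (union λ i → b (prefix e i))

module _ {S T : Space} {f : Point S → Point T} where

  borelFunction : (∀ {U} → Open T U → Borel S (f ⊢ U)) → BorelFunction S T f
  borelFunction f⁻¹ _ (generator U)  = f⁻¹ U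
  borelFunction f⁻¹ _ (complement b) = complement (borelFunction f⁻¹ _ b)
  borelFunction f⁻¹ _ (union b)      = union λ n → borelFunction f⁻¹ _ (b n)
  borelFunction f⁻¹ _ (resp-≐ (P⊆Q , Q⊆P) b) =
    resp-≐ ((λ p → P⊆Q p) , (λ q → Q⊆P q)) (borelFunction f⁻¹ _ b)

  continuous-borel : (∀ {p q n} → Ball S p n q → Ball T (f p) n (f q)) → BorelFunction S T f
  continuous-borel cont = borelFunction λ openU → generator λ p∈U →
    let n , ball = openU p∈U in n , λ p≈q → ball (cont p≈q)

coordinate-open : ∀ {A : Set} i a → Open (Seq A) (λ y → y i ≡ a)
coordinate-open i a yi≡a = suc i , λ y≈ → trans (sym (y≈ i ≤-refl)) yi≡a

module _ {S : Space} {A : Set} {f : Point S → ℕ → A} where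

  coordinate-borel : BorelFunction S (Seq A) f → ∀ i a → Borel S (λ p → f p i ≡ a)
  coordinate-borel bf i a = bf (λ y → y i ≡ a) (generator (coordinate-open i a))

-- Borel closure properties by classical logic

module Classical (em : ExcludedMiddle (lsuc 0ℓ)) where

  em₀ : (P : Set) → Dec P
  em₀ P = map′ lower lift (em {Lift (lsuc 0ℓ) P})

  ¬¬-elim : {P : Set} → ¬ ¬ P → P
  ¬¬-elim = decidable-stable (em₀ _)

  ¬∀⇒∃¬ : {I : Set} {P : I → Set} → ¬ (∀ i → P i) → ∃ λ i → ¬ P i
  ¬∀⇒∃¬ ¬∀ = ¬¬-elim λ ¬∃ → ¬∀ λ i → ¬¬-elim λ ¬p → ¬∃ (i , ¬p)

  module _ {S : Space} where

    borel-∀ : {I : Set} → ℕ ↠ I → {P : I → Pred (Point S) 0ℓ} →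
              (∀ i → Borel S (P i)) → Borel S (λ x → ∀ i → P i x)
    borel-∀ e b = resp-≐
      ( (λ ¬∃ i → ¬¬-elim λ ¬p → ¬∃ (i , ¬p)) , (λ p (i , ¬p) → ¬p (p i)) )
      (complement (borel-∃ e (λ i → complement (b i))))

    borel-× : ∀ {P Q} → Borel S P → Borel S Q → Borel S (λ x → P x × Q x)
    borel-× {P} {Q} p q = resp-≐
      ( (λ r → r false , r true) , (λ { (r , s) false → r ; (r , s) true → s }) )
      (borel-∀ ℕ↠Bool {λ b x → if b then Q x else P x} λ { false → p ; true → q })

    borel-→ : ∀ {P Q} → Borel S P → Borel S Q → Borel S (λ x → P x → Q x)
    borel-→ {P} {Q} p q = resp-≐ (to , from) (borel-⊎ (complement p) q)
      where
      to : ∀ {x} → ¬ P x ⊎ Q x → P x → Q x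
      to (inj₁ ¬p) p = contradiction p ¬p
      to (inj₂ q)  _ = q

      from : ∀ {x} → (P x → Q x) → ¬ P x ⊎ Q x
      from {x} g with em₀ (P x)
      ... | yes p = inj₂ (g p)
      ... | no ¬p = inj₁ ¬p

    borel-∀Seq : {A : Set} → ℕ ↠ A → ∀ n {P : (ℕ → A) → Pred (Point S) 0ℓ} →
                 (∀ {y y′} → Ball (Seq A) y n y′ → P y ⊆ P y′) →
                 (∀ y → Borel S (P y)) → Borel S (λ x → ∀ y → P y x)
    borel-∀Seq e n local b = resp-≐
      ( (λ ¬∃ y → ¬¬-elim λ ¬p → ¬∃ (y , ¬p)) , (λ p (y , ¬p) → ¬p (p y)) )
      (complement (borel-∃Seq e n (λ y≈ ¬p p → ¬p (local (≈-sym y≈) p)) (complement ∘ b)))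

  -- An open set is the union of the countably many basic balls inside it, and the preimage of a
  -- ball is a finite intersection of coordinate conditions. That a ball lies in `U` does not depend
  -- on `p`, so it enters as a constant.
  coordinatewise-borel : ∀ {S : Space} {A : Set} → ℕ ↠ A → {f : Point S → ℕ → A} →
                         (∀ i a → Borel S (λ p → f p i ≡ a)) → BorelFunction S (Seq A) f
  coordinatewise-borel {S} {A} e {f} b = borelFunction λ {U} openU → resp-≐
    ( (λ (n , y , ball , y≈) → ball y≈)
    , (λ {p} fp∈U → let n , ball = openU fp∈U in n , f p , (λ {y} → ball {y}) , λ _ _ → refl) )
    (borel-∃ ℕ↠ℕ {λ n p → ∃ λ y → InBall U n y p} λ n →
     borel-∃Seq e n {InBall U n}
       (λ y≈y′ (ball , y≈) → (λ {z} y′≈ → ball {z} (≈-trans y≈y′ y′≈)) , ≈-trans (≈-sym y≈y′) y≈)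
       λ y → borel-× (borel-const _) (borel-∀ ℕ↠ℕ λ i → borel-→ (borel-const (i < n))
         (resp-≐ (sym , sym) (b i (y i)))))
    where
    InBall : Pred (ℕ → A) 0ℓ → ℕ → (ℕ → A) → Pred (Point S) 0ℓ
    InBall U n y p = (Ball (Seq A) y n ⊆ U) × Ball (Seq A) y n (f p)

  -- Least witnesses, with default value 0

  IsLeast : Pred ℕ 0ℓ → Pred ℕ 0ℓ
  IsLeast P n = P n × (∀ m → m < n → ¬ P m)

  isLeast-unique : ∀ {P m n} → IsLeast P m → IsLeast P n → m ≡ n
  isLeast-unique {_} {m} {n} (p , m-least) (q , n-least) with <-cmp m n
  ... | tri< m<n _ _ = contradiction p (n-least m m<n)
  ... | tri≈ _ m≡n _ = m≡n
  ... | tri> _ _ n<m = contradiction q (m-least n n<m)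

  search : ∀ P n → ∃ (IsLeast P) ⊎ (∀ m → m < n → ¬ P m)
  search P zero    = inj₂ λ _ ()
  search P (suc n) with search P n | em₀ (P n)
  ... | inj₁ found | _     = inj₁ found
  ... | inj₂ none  | yes p = inj₁ (n , p , none)
  ... | inj₂ none  | no ¬p = inj₂ λ m m<1+n → [ none m , (λ { refl → ¬p }) ]′ (m<1+n⇒m<n∨m≡n m<1+n)

  leastOr0 : ∀ {P : Pred ℕ 0ℓ} → Dec (∃ (IsLeast P)) → ℕ
  leastOr0 (yes (n , _)) = n
  leastOr0 (no _)        = zero

  μ : Pred ℕ 0ℓ → ℕ
  μ P = leastOr0 (em₀ (∃ (IsLeast P)))

  μ-isLeast : ∀ {P} → ∃ P → IsLeast P (μ P)
  μ-isLeast {P} (n , p) with em₀ (∃ (IsLeast P))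
  ... | yes (_ , least) = least
  ... | no  ¬least with search P (suc n)
  ...   | inj₁ least = contradiction least ¬least
  ...   | inj₂ none  = contradiction p (none n ≤-refl)

  -- Besides the points whose least witness is `n`, the level set for `n = 0` contains the points
  -- without any witness, because of the default value.
  borel-μ : ∀ {S : Space} {P : ℕ → Pred (Point S) 0ℓ} → (∀ n → Borel S (P n)) →
            ∀ n → Borel S (λ x → μ (λ m → P m x) ≡ n)
  borel-μ {S} {P} b n = resp-≐ (to , from)
    (borel-⊎ (borel-least n)
             (borel-× (complement (borel-∃ ℕ↠ℕ borel-least)) (borel-const (zero ≡ n))))
    where
    Least : ℕ → Pred (Point S) 0ℓ
    Least m x = IsLeast (λ m → P m x) m

    borel-least : ∀ m → Borel S (Least m)
    borel-least m = borel-× (b m)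
      (borel-∀ ℕ↠ℕ λ k → borel-→ (borel-const (k < m)) (complement (b k)))

    to : ∀ {x} → Least n x ⊎ (¬ ∃ (λ m → Least m x)) × zero ≡ n → μ (λ m → P m x) ≡ n
    to (inj₁ least) = isLeast-unique (μ-isLeast (n , proj₁ least)) least
    to {x} (inj₂ (none , 0≡n)) with em₀ (∃ (IsLeast (λ m → P m x)))
    ... | yes least = contradiction least none
    ... | no _      = 0≡n

    from : ∀ {x} → μ (λ m → P m x) ≡ n → Least n x ⊎ (¬ ∃ (λ m → Least m x)) × zero ≡ n
    from {x} μ≡n with em₀ (∃ (IsLeast (λ m → P m x)))
    ... | yes (m , least) = inj₁ (subst (λ m → Least m x) μ≡n least)
    ... | no none         = inj₂ (none , μ≡n)

  -- Meager sets

  abstract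
    -- `E j n y` says that the ball of radius `n` around `y` misses `N j`. This codes the exterior
    -- of `N j`, which is dense because `N j` is nowhere dense.
    meager⇒denseOpen : ∀ {A} → Meager Cantor A →
      ∃ λ (E : ℕ → ℕ → Pred 2^ω 0ℓ) →
        (∀ j → DenseOpen (E j)) × (∀ {y} → y ∈ A → ∃ λ j → ∀ n → ¬ E j n y)
    meager⇒denseOpen (N , nowhereDense , A⊆N) =
      (λ j n y → ∀ y′ → Ball Cantor y n y′ → ¬ N j y′)
      , (λ j → record
          { local = λ y≈y′ p z y′≈z → p z (≈-trans y≈y′ y′≈z)
          ; grow  = λ p z y≈z → p z (≈-mono (n≤1+n _) y≈z)
          ; dense = λ y n →
              let y′ , q = ¬∀⇒∃¬ λ ball → nowhereDense j y (n , λ {y′} → ball y′)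
                  y≈y′ , ¬closure = ¬→⇒×¬ q
                  m , disjoint = ¬∀⇒∃¬ ¬closure
              in y′ , m , y≈y′ , λ z y′≈z z∈N → disjoint (z , y′≈z , z∈N)
          })
      , λ {y} y∈A → let j , y∈N = A⊆N y∈A in j , λ n p → p y (λ _ _ → refl) y∈N
      where
      ¬→⇒×¬ : {P Q : Set} → ¬ (P → Q) → P × ¬ Q
      ¬→⇒×¬ ¬f = ¬¬-elim (λ ¬p → ¬f λ p → contradiction p ¬p) , λ q → ¬f λ _ → q

  denseOpen⇒meager : ∀ {A} {E : ℕ → ℕ → Pred 2^ω 0ℓ} → (∀ j → DenseOpen (E j)) →
    (∀ {y} → y ∈ A → ∃ λ j → ∀ n → ¬ E j n y) → Meager Cantor A
  denseOpen⇒meager {E = E} d A⊆ = (λ j y → ∀ n → ¬ E j n y) , nowhereDense , A⊆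
    where
    nowhereDense : ∀ j → NowhereDense Cantor (λ y → ∀ n → ¬ E j n y)
    nowhereDense j y (n , ball) =
      let y′ , m , y≈y′ , p = dense (d j) y n
          z , y′≈z , ¬p     = ball y≈y′ m
      in ¬p m (local (d j) y′≈z p)

  meager-⊆ : ∀ {A B} → A ⊆ B → Meager Cantor B → Meager Cantor A
  meager-⊆ A⊆B (N , nowhereDense , B⊆N) = N , nowhereDense , λ a → B⊆N (A⊆B a)

  -- Following any word of length `n` by zeros up to `N` gives a ball disjoint from `A`.
  hitting⇒nowhereDense : ∀ {A} →
    (∀ n → ∃ λ N → ∀ {y} → y ∈ A → ∃ λ i → n ≤ i × i < N × y i ≡ true) →
    NowhereDense Cantor A
  hitting⇒nowhereDense hit y (n , ball) =
    let N , hits = hit n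
        z , y′≈z , z∈A = ball (splice-< n y zeros) N
        i , n≤i , i<N , zi≡true = hits z∈A
    in contradiction (trans (sym (splice-≥ y zeros n≤i)) (trans (y′≈z i i<N) zi≡true)) λ ()
    where
    zeros : 2^ω
    zeros _ = false

  -- The Baire property with parameters

  -- A is a Borel family of codes, for the set { (x , y) | ∃ n, x ∈ A n y }.
  record BorelOpen (A : ℕ → 2^ω → Pred 2^ω 0ℓ) : Set₁ where
    field
      borel  : ∀ n y → Borel Cantor (A n y)
      localᵇ : ∀ {n y y′} → Ball Cantor y n y′ → A n y ⊆ A n y′
      growᵇ  : ∀ {n y} → A n y ⊆ A (suc n) y

    growᵇ-≤ : ∀ {m n y} → m ≤ n → A m y ⊆ A n y
    growᵇ-≤ {n = zero}  z≤n p = p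
    growᵇ-≤ {m} {suc n} m≤n p with m≤n⇒m<n∨m≡n m≤n
    ... | inj₁ (s≤s m≤n′) = growᵇ (growᵇ-≤ m≤n′ p)
    ... | inj₂ refl       = p

  open BorelOpen

  -- The Baire property of all sections at once: each `(H)_x` equals an open set on a comeager set,
  -- with both coded in a Borel way in `x`.
  record ModuloMeager (H : Pred (2^ω × 2^ω) 0ℓ) : Set₁ where
    field
      U      : ℕ → 2^ω → Pred 2^ω 0ℓ
      D      : ℕ → ℕ → 2^ω → Pred 2^ω 0ℓ
      U-open : BorelOpen U
      D-open : ∀ j → BorelOpen (D j)
      D-dense : ∀ j x y n → ∃ λ y′ → ∃ λ m → Ball Cantor y n y′ × x ∈ D j m y′
      H⇔U    : ∀ {x y} → (∀ j → ∃ λ n → x ∈ D j n y) → (x , y) ∈ H ⇔ ∃ λ n → x ∈ U n y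

    D-denseOpen : ∀ j x → DenseOpen (λ n y → x ∈ D j n y)
    D-denseOpen j x = record
      { local = λ y≈y′ → localᵇ (D-open j) y≈y′
      ; grow  = growᵇ (D-open j)
      ; dense = D-dense j x
      }

  open ModuloMeager
  open Equivalence

  open-moduloMeager : ∀ {H} → Open (Cantor ⊗ Cantor) H → ModuloMeager H
  open-moduloMeager {H} openH = record
    { U      = λ n y x → Box n x y
    ; D      = λ _ _ _ _ → ⊤
    ; U-open = record
        { borel  = λ n y → generator λ {x} box → n , λ x≈x′ x″ y′ x′≈x″ → box x″ y′ (≈-trans x≈x′ x′≈x″)
        ; localᵇ = λ y≈y′ box x′ z x≈x′ y′≈z → box x′ z x≈x′ (≈-trans y≈y′ y′≈z)
        ; growᵇ  = λ box x′ z x≈x′ y≈z → box x′ z (≈-mono (n≤1+n _) x≈x′) (≈-mono (n≤1+n _) y≈z)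
        }
    ; D-open = λ _ → record { borel = λ _ _ → borel-const ⊤ ; localᵇ = λ _ _ → tt ; growᵇ = λ _ → tt }
    ; D-dense = λ _ _ y n → y , n , (λ _ _ → refl) , tt
    ; H⇔U    = λ {x} {y} _ → mk⇔
        (λ xy∈H → let n , ball = openH xy∈H in n , λ x′ y′ x≈x′ y≈y′ → ball (x≈x′ , y≈y′))
        (λ (n , box) → box x y (λ _ _ → refl) (λ _ _ → refl))
    }
    where
    Box : ℕ → 2^ω → 2^ω → Set
    Box n x y = ∀ x′ y′ → Ball Cantor x n x′ → Ball Cantor y n y′ → H (x′ , y′)

  -- In each section `V` is the exterior of `U`. Adding the dense open set `U ∪ V` as a new
  -- genericity condition removes the boundary, where neither is available.
  ∁-moduloMeager : ∀ {H} → ModuloMeager H → ModuloMeager (∁ H)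
  ∁-moduloMeager {H} M = record
    { U       = V
    ; D       = D′
    ; U-open  = V-open
    ; D-open  = λ { zero → record
                      { borel  = λ n y → borel-⊎ (borel (U-open M) n y) (borel V-open n y)
                      ; localᵇ = λ y≈y′ → λ { (inj₁ u) → inj₁ (localᵇ (U-open M) y≈y′ u)
                                            ; (inj₂ v) → inj₂ (localᵇ V-open y≈y′ v) }
                      ; growᵇ  = λ { (inj₁ u) → inj₁ (growᵇ (U-open M) u)
                                   ; (inj₂ v) → inj₂ (growᵇ V-open v) }
                      }
                  ; (suc j) → D-open M j }
    ; D-dense = λ { zero → U∪V-dense ; (suc j) → D-dense M j }
    ; H⇔U     = λ {x} {y} generic →
        let H⇔U′ = H⇔U M (generic ∘ suc) in mk⇔
        (λ ¬h → outside ¬h H⇔U′ (generic zero))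
        (λ (n , v) h → let m , u = to H⇔U′ h in v y m (λ _ _ → refl) u)
    }
    where
    V : ℕ → 2^ω → Pred 2^ω 0ℓ
    V n y x = ∀ y′ m → Ball Cantor y n y′ → ¬ U M m y′ x

    D′ : ℕ → ℕ → 2^ω → Pred 2^ω 0ℓ
    D′ zero    n y x = U M n y x ⊎ V n y x
    D′ (suc j) = D M j

    V-open : BorelOpen V
    V-open = record
      { borel  = λ n y → resp-≐ ((λ p y′ m → p m y′) , (λ p m y′ → p y′ m))
          -- The condition on `y′` reads only its first `n` and first `m` entries, so prefixes of
          -- length `n + m` suffice.
          (borel-∀ ℕ↠ℕ λ m → borel-∀Seq ℕ↠Bool (n + m) {λ y′ x → Ball Cantor y n y′ → ¬ U M m y′ x}
            (λ y′≈y″ p y≈y″ u → p (≈-trans y≈y″ (≈-sym (≈-mono (m≤m+n n m) y′≈y″)))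
                                  (localᵇ (U-open M) (≈-sym (≈-mono (m≤n+m m n) y′≈y″)) u))
            λ y′ → borel-→ (borel-const _) (complement (borel (U-open M) m y′)))
      ; localᵇ = λ y≈y′ v z m y′≈z → v z m (≈-trans y≈y′ y′≈z)
      ; growᵇ  = λ v z m y≈z → v z m (≈-mono (n≤1+n _) y≈z)
      }

    U∪V-dense : ∀ x y n → ∃ λ y′ → ∃ λ m → Ball Cantor y n y′ × (U M m y′ x ⊎ V m y′ x)
    U∪V-dense x y n with em₀ (∃ λ y′ → ∃ λ m → Ball Cantor y n y′ × U M m y′ x)
    ... | yes (y′ , m , y≈y′ , u) = y′ , m , y≈y′ , inj₁ u
    ... | no none = y , n , (λ _ _ → refl) , inj₂ λ y′ m y≈y′ u → none (y′ , m , y≈y′ , u)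

    outside : ∀ {x y} → ¬ H (x , y) → H (x , y) ⇔ (∃ λ n → U M n y x) →
              (∃ λ n → U M n y x ⊎ V n y x) → ∃ λ n → V n y x
    outside ¬h H⇔U′ (n , inj₁ u) = contradiction (from H⇔U′ (n , u)) ¬h
    outside ¬h H⇔U′ (n , inj₂ v) = n , v

  ⋃-moduloMeager : ∀ {H : ℕ → Pred (2^ω × 2^ω) 0ℓ} → (∀ i → ModuloMeager (H i)) →
                   ModuloMeager (λ z → ∃ λ i → H i z)
  ⋃-moduloMeager M = record
    { U      = λ n y x → ∃ λ i → U (M i) n y x
    -- A generic point must be generic for every `H i`; the doubly indexed conditions are listed in
    -- one sequence.
    ; D      = λ j → let i , k = unpair j in D (M i) k
    ; U-open = record
        { borel  = λ n y → union λ i → borel (U-open (M i)) n y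
        ; localᵇ = λ y≈y′ (i , u) → i , localᵇ (U-open (M i)) y≈y′ u
        ; growᵇ  = λ (i , u) → i , growᵇ (U-open (M i)) u
        }
    ; D-open  = λ j → let i , k = unpair j in D-open (M i) k
    ; D-dense = λ j → let i , k = unpair j in D-dense (M i) k
    ; H⇔U     = λ {x} {y} generic →
        let H⇔U′ = λ i → H⇔U (M i) λ k →
              let j , unpair≡ = unpair-surjective i k
              in subst (λ (i , k) → ∃ λ n → x ∈ D (M i) k n y) unpair≡ (generic j)
        in mk⇔ (λ (i , h) → let n , u = to (H⇔U′ i) h in n , i , u)
               (λ (n , i , u) → i , from (H⇔U′ i) (n , u))
    }

  borel⇒moduloMeager : ∀ {H} → Borel (Cantor ⊗ Cantor) H → ModuloMeager H
  borel⇒moduloMeager (generator openH)      = open-moduloMeager openH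
  borel⇒moduloMeager (complement b)         = ∁-moduloMeager (borel⇒moduloMeager b)
  borel⇒moduloMeager (union b)              = ⋃-moduloMeager (λ i → borel⇒moduloMeager (b i))
  borel⇒moduloMeager (resp-≐ (P⊆H , H⊆P) b) = record
    { U = U M ; D = D M ; U-open = U-open M ; D-open = D-open M ; D-dense = D-dense M
    ; H⇔U = λ generic → mk⇔ (to (H⇔U M generic) ∘ H⊆P) (P⊆H ∘ from (H⇔U M generic)) }
    where M = borel⇒moduloMeager b

  -- By the Baire category theorem the open part of a set with meager sections is empty.
  𝓜-set-misses : ∀ {H} (M : ModuloMeager H) {x y} → Meager Cantor (Section H x) →
                 (x , y) ∈ H → ∃ λ j → ∀ n → x ∉ D M j n y
  𝓜-set-misses M {x} {y} meager xy∈H = ¬¬-elim λ none →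
    let generic = λ j → ¬¬-elim λ ¬d → none (j , λ n d → ¬d (n , d))
        n , u   = to (H⇔U M generic) xy∈H
        E , E-dense , avoids = meager⇒denseOpen meager
        -- The point `y′` stays in the open part near `y`, is generic for `M`, and avoids the meager
        -- section; the first two put it in that section.
        y′ , y≈y′ , meets    = baire-category (λ j → ∩ᵈ-denseOpen (D-denseOpen M j x) (E-dense j)) y n
        xy′∈H = from (H⇔U M λ j → let m , d , _ = meets j in m , d) (n , localᵇ (U-open M) y≈y′ u)
        j , missed = avoids xy′∈H
        m , _ , e  = meets j
    in missed m e

  -- Borel functions on a subspace

  module _ {X : Pred 2^ω 0ℓ} where

    restriction-borel : ∀ {Q} → Borel Cantor Q → Borel (Subspace Cantor X) (proj₁ ⊢ Q)
    restriction-borel = continuous-borel id _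

    trace : ∀ {P} → Borel (Subspace Cantor X) P →
            ∃ λ Q → Borel Cantor Q × (∀ p → P p ⇔ Q (proj₁ p))
    trace {P} (generator openP) =
      -- The ambient open set is the union of the full balls around points of `X` whose relative
      -- balls lie in `P`.
      (λ y → ∃ λ p → ∃ λ n → (∀ q → Near p n q → P q) × Ball Cantor (proj₁ p) n y)
      , generator (λ (p , n , ball , p≈y) → n , λ y≈y′ → p , n , ball , ≈-trans p≈y y≈y′)
      , λ p → mk⇔
        (λ p∈P → let n , ball = openP p∈P in p , n , (λ _ near → ball near) , λ _ _ → refl)
        (λ (q , n , ball , q≈p) → ball p q≈p)
      where
      Near = Space._≈[_]_ (Subspace Cantor X)
    trace (complement b) =
      let Q , bQ , P⇔Q = trace b
      in ∁ Q , complement bQ , λ p → mk⇔ (_∘ from (P⇔Q p)) (_∘ to (P⇔Q p))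
    trace (union b) =
      (λ y → ∃ λ n → proj₁ (trace (b n)) y)
      , union (λ n → proj₁ (proj₂ (trace (b n))))
      , λ p → mk⇔ (λ (n , q) → n , to   (proj₂ (proj₂ (trace (b n))) p) q)
                  (λ (n , q) → n , from (proj₂ (proj₂ (trace (b n))) p) q)
    trace (resp-≐ (P⊆P′ , P′⊆P) b) =
      let Q , bQ , P⇔Q = trace b
      in Q , bQ , λ p → mk⇔ (to (P⇔Q p) ∘ P′⊆P) (P⊆P′ ∘ from (P⇔Q p))

    abstract
      -- Each fibre of a coordinate is the trace of a Borel set of the whole space. The least index
      -- of such a set containing `x` gives the value, and points in none of them get the default
      -- index.
      extension : {A : Set} → ℕ ↠ A → ∀ f → BorelFunction (Subspace Cantor X) (Seq A) f →
                  ∃ λ f̃ → BorelFunction Cantor (Seq A) f̃ × (∀ p → f̃ (proj₁ p) ≗ f p)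
      extension {A} e f bf = f̃ , coordinatewise-borel e f̃-borel , extends
        where
        value : ℕ → A
        value = Surjection.to e

        fibre : ∀ i n → ∃ λ Q → Borel Cantor Q × (∀ p → (f p i ≡ value n) ⇔ Q (proj₁ p))
        fibre i n = trace (coordinate-borel bf i (value n))

        index : ℕ → 2^ω → ℕ
        index i x = μ (λ n → proj₁ (fibre i n) x)

        f̃ : 2^ω → ℕ → A
        f̃ x i = value (index i x)

        f̃-borel : ∀ i a → Borel Cantor (λ x → f̃ x i ≡ a)
        f̃-borel i a = resp-≐
          ( (λ { (n , refl , q) → q }) , (λ {x} q → index i x , refl , q) )
          (borel-∃ ℕ↠ℕ λ n → borel-× (borel-μ (λ n → proj₁ (proj₂ (fibre i n))) n)
                                     (borel-const (value n ≡ a)))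

        extends : ∀ p → f̃ (proj₁ p) ≗ f p
        extends p i =
          let n , value≡  = Surjection.strictlySurjective e (f p i)
              inFibre , _ = μ-isLeast {λ n → proj₁ (fibre i n) (proj₁ p)}
                            (n , to (proj₂ (proj₂ (fibre i n)) p) (sym value≡))
          -- The least index may differ from `n`, but lying in its fibre already determines the
          -- value of `f p i`.
          in sym (from (proj₂ (proj₂ (fibre i (index i (proj₁ p)))) p) inFibre)

  -- Translations and spread sets

  ⊞-cancel : ∀ x y → x ⊞ (x ⊞ y) ≗ y
  ⊞-cancel x y i = trans (sym (xor-assoc (x i) (x i) (y i)))
    (trans (cong (_xor y i) (xor-same (x i))) (xor-identityˡ (y i)))

  ⊞-≈ : ∀ {n} x {y y′} → Ball Cantor y n y′ → Ball Cantor (x ⊞ y) n (x ⊞ y′)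
  ⊞-≈ x y≈y′ i i<n = cong (x i xor_) (y≈y′ i i<n)

  translate-denseOpen : ∀ {E} c → DenseOpen E → DenseOpen (λ n y → E n (c ⊞ y))
  translate-denseOpen c d = record
    { local = λ y≈y′ → local d (⊞-≈ c y≈y′)
    ; grow  = grow d
    ; dense = λ y n →
        let y′ , m , cy≈y′ , p = dense d (c ⊞ y) n
        in c ⊞ y′ , m
         , (λ i i<n → trans (sym (⊞-cancel c y i)) (⊞-≈ c cy≈y′ i i<n))
         , local d (λ i _ → sym (⊞-cancel c y′ i)) p
    }

  -- The y with a one in each interval [ i , i + max_{l ≤ i} v l ].
  Spread : ω^ω → Pred 2^ω 0ℓ
  Spread v y = ∀ i → ∃ λ j → i ≤ j × y j ≡ true × (∃ λ l → l ≤ i × j ≤ i + v l)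

  -- The requirement at `i = n` involves only `v l` for `l ≤ n`, so a common bound on these values
  -- limits how far away the one can be.
  spread-nowhereDense : ∀ v → NowhereDense Cantor (Spread v)
  spread-nowhereDense v = hitting⇒nowhereDense {Spread v} λ n →
    let b , v≤b = bound n
    in suc (n + b) , λ y∈ →
      let j , n≤j , yj , l , l≤n , j≤ = y∈ n
      in j , n≤j , s≤s (≤-trans j≤ (+-monoʳ-≤ n (v≤b l l≤n))) , yj
    where
    bound : ∀ n → ∃ λ b → ∀ l → l ≤ n → v l ≤ b
    bound zero    = v 0 , λ { _ z≤n → ≤-refl }
    bound (suc n) =
      let b , v≤b = bound n
      in b ⊔ v (suc n) , λ l l≤1+n →
        [ (λ { (s≤s l≤n) → ≤-trans (v≤b l l≤n) (m≤m⊔n b _) })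
        , (λ { refl → m≤n⊔m b _ }) ]′ (m≤n⇒m<n∨m≡n l≤1+n)

  module _ {E : ℕ → ℕ → Pred 2^ω 0ℓ} (d : ∀ j → DenseOpen (E j)) where

    open Steering d

    -- Concatenate the words of the blocks that v jumps over (Bad), with ones elsewhere
    -- and at all left endpoints: the result is in Spread v, and it is in E j if block k
    -- is bad for some k ≥ j.
    spread-dominated : ∀ v → (∀ {y} → y ∈ Spread v → ∃ λ j → ∀ n → ¬ E j n y) →
                       ∃ λ m → ∀ k → m ≤ k → v k ≤ endpoint (suc k)
    spread-dominated v avoids =
      let m , good = eventually-good
      -- If `v k` reached `endpoint (suc k)`, then `l = k` would make block `k` bad, since
      -- `k ≤ endpoint k`.
      in m , λ k m≤k → <⇒≤ (≰⇒> λ b′≤v → good k m≤k (k , k≤endpoint k , b′≤v))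
      where
      Bad : ℕ → Set
      Bad k = ∃ λ l → l ≤ endpoint k × endpoint (suc k) ≤ v l

      pieceFrom : ∀ k i → Dec (Bad k × endpoint k < i) → Bool
      pieceFrom k i (yes _) = word k i
      pieceFrom k i (no _)  = true

      piece : ℕ → 2^ω
      piece k i = pieceFrom k i (em₀ (Bad k × endpoint k < i))

      piece-bad : ∀ k i → Bad k → endpoint k < i → piece k i ≡ word k i
      piece-bad k i bad b<i with em₀ (Bad k × endpoint k < i)
      ... | yes _ = refl
      ... | no ¬p = contradiction (bad , b<i) ¬p

      piece-good : ∀ k i → ¬ (Bad k × endpoint k < i) → piece k i ≡ true
      piece-good k i ¬p with em₀ (Bad k × endpoint k < i)
      ... | yes p = contradiction p ¬p
      ... | no _  = refl

      glued : 2^ω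
      glued = glue piece

      glued∈Spread : glued ∈ Spread v
      glued∈Spread i with locate i
      ... | k , b≤i , i<b′ with em₀ (Bad k)
      -- In a bad block the one is found at the next left endpoint, which is always free, and the
      -- jump of `v l` is long enough to allow this. In a good block `i` itself carries a one.
      ...   | yes (l , l≤b , b′≤v) =
        endpoint (suc k) , <⇒≤ i<b′
        , trans (glue-≡ piece {suc k} (≤-refl , endpoint-< (suc k)))
                (piece-good (suc k) _ λ (_ , b<b) → <-irrefl refl b<b)
        , l , ≤-trans l≤b b≤i , ≤-trans b′≤v (m≤n+m _ i)
      ...   | no ¬bad =
        i , ≤-refl , trans (glue-≡ piece {k} (b≤i , i<b′)) (piece-good k i λ (bad , _) → ¬bad bad)
        , zero , z≤n , m≤m+n i _

      glued-meets : ∀ j k → j ≤ k → Bad k → E j (endpoint (suc k)) glued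
      glued-meets j k j≤k bad = word-steers {j} {k} {glued} j≤k λ i b<i i<b′ →
        sym (trans (glue-≡ piece {k} (<⇒≤ b<i , i<b′)) (piece-bad k i bad b<i))

      eventually-good : ∃ λ m → ∀ k → m ≤ k → ¬ Bad k
      eventually-good =
        let j , missed = avoids glued∈Spread
        in j , λ k j≤k bad → missed (endpoint (suc k)) (glued-meets j k j≤k bad)

  -- The two directions of the equivalence

  module _ {X : Pred 2^ω 0ℓ} where

    SR𝓜⇒additive : SR𝓜 X → ∀ f → BorelFunction (Subspace Cantor X) Cantor f → 𝓜-additive (Image f)
    SR𝓜⇒additive sr f bf F F-meager = meager-⊆ covers (sr H (H-borel , H-meager))
      where
      f̃ : 2^ω → 2^ω
      f̃ = proj₁ (extension ℕ↠Bool f bf)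

      f̃-borel : BorelFunction Cantor Cantor f̃
      f̃-borel = proj₁ (proj₂ (extension ℕ↠Bool f bf))

      extends : ∀ p → f̃ (proj₁ p) ≗ f p
      extends = proj₂ (proj₂ (extension ℕ↠Bool f bf))

      E : ℕ → ℕ → Pred 2^ω 0ℓ
      E = proj₁ (meager⇒denseOpen F-meager)

      E-denseOpen : ∀ j → DenseOpen (E j)
      E-denseOpen = proj₁ (proj₂ (meager⇒denseOpen F-meager))

      F-avoids : ∀ {y} → y ∈ F → ∃ λ j → ∀ n → ¬ E j n y
      F-avoids = proj₂ (proj₂ (meager⇒denseOpen F-meager))

      -- `F` may fail to be Borel, so it is replaced by the larger meager set of points outside some
      -- `E j`, which is a countable union of closed sets.
      H : Pred (2^ω × 2^ω) 0ℓ
      H (x , y) = ∃ λ j → ∀ n → ¬ E j n (f̃ x ⊞ y)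

      sum-borel : BorelFunction (Cantor ⊗ Cantor) Cantor (λ (x , y) → f̃ x ⊞ y)
      sum-borel = coordinatewise-borel ℕ↠Bool λ i a → resp-≐
        ( (λ { (_ , _ , refl , refl , q) → q }) , (λ q → _ , _ , refl , refl , q) )
        (borel-∃ ℕ↠Bool λ b → borel-∃ ℕ↠Bool λ c →
          borel-× (continuous-borel {f = proj₁} proj₁ _ (coordinate-borel f̃-borel i b))
          (borel-× (continuous-borel {f = proj₂} proj₂ _ (generator (coordinate-open i c)))
                   (borel-const (b xor c ≡ a))))

      H-borel : Borel (Cantor ⊗ Cantor) H
      H-borel = sum-borel (λ y → ∃ λ j → ∀ n → ¬ E j n y)
        (union λ j → borel-∀ ℕ↠ℕ λ n → complement
          (generator λ e → n , λ y≈y′ → local (E-denseOpen j) y≈y′ e))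

      H-meager : ∀ x → Meager Cantor (Section H x)
      H-meager x = denseOpen⇒meager (λ j → translate-denseOpen (f̃ x) (E-denseOpen j)) id

      covers : Image f ⊕ F ⊆ (λ y → ∃ λ x → x ∈ X × y ∈ Section H x)
      covers {z} (y , w , ((x , x∈X) , fp≗y) , w∈F , y⊞w≗z) =
        let j , missed = F-avoids w∈F
        in x , x∈X , j , λ n e → missed n (local (E-denseOpen j) (λ i _ → f̃x⊞z≗w i) e)
        where
        f̃x⊞z≗w : f̃ x ⊞ z ≗ w
        f̃x⊞z≗w i = trans
          (cong₂ _xor_ (trans (extends (x , x∈X) i) (fp≗y i)) (sym (y⊞w≗z i)))
          (⊞-cancel y w i)

    -- The partition is built from a meager cover of the union of all sections, hence independently
    -- of `x`; only the threshold of domination varies with `x`.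
    SR𝓜⇒bounded : SR𝓜 X → ∀ f → BorelFunction (Subspace Cantor X) Baire f → Bounded (Image f)
    SR𝓜⇒bounded sr f bf = (λ i → endpoint (suc i)) , dominates
      where
      f̃ : 2^ω → ω^ω
      f̃ = proj₁ (extension ℕ↠ℕ f bf)

      f̃-borel : BorelFunction Cantor Baire f̃
      f̃-borel = proj₁ (proj₂ (extension ℕ↠ℕ f bf))

      extends : ∀ p → f̃ (proj₁ p) ≗ f p
      extends = proj₂ (proj₂ (extension ℕ↠ℕ f bf))

      H : Pred (2^ω × 2^ω) 0ℓ
      H (x , y) = y ∈ Spread (f̃ x)

      H-borel : Borel (Cantor ⊗ Cantor) H
      H-borel = borel-∀ ℕ↠ℕ λ i → borel-∃ ℕ↠ℕ λ j →
        borel-× (borel-const (i ≤ j))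
        (borel-× (continuous-borel {f = proj₂} proj₂ _ (generator (coordinate-open j true)))
        (borel-∃ ℕ↠ℕ λ l → borel-× (borel-const (l ≤ i))
          (continuous-borel {f = proj₁} proj₁ _
            (f̃-borel (λ v → j ≤ i + v l) (generator λ {v} j≤ → suc l , λ v≈v′ →
              subst (λ a → j ≤ i + a) (v≈v′ l ≤-refl) j≤)))))

      H-meager : ∀ x → Meager Cantor (Section H x)
      H-meager x = (λ _ → Section H x) , (λ _ → spread-nowhereDense (f̃ x)) , (0 ,_)

      union-meager : Meager Cantor (λ y → ∃ λ x → x ∈ X × y ∈ Section H x)
      union-meager = sr H (H-borel , H-meager)

      E-denseOpen = proj₁ (proj₂ (meager⇒denseOpen union-meager))
      union-avoids = proj₂ (proj₂ (meager⇒denseOpen union-meager))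

      open Steering E-denseOpen

      dominates : ∀ v → v ∈ Image f → ∃ λ m → ∀ n → m ≤ n → v n ≤ endpoint (suc n)
      dominates v ((x , x∈X) , fp≗v) =
        let m , dominated = spread-dominated E-denseOpen (f̃ x) λ y∈ → union-avoids (x , x∈X , y∈)
        in m , λ n m≤n → subst (_≤ endpoint (suc n))
             (trans (extends (x , x∈X) n) (fp≗v n)) (dominated n m≤n)

    -- The bound makes one interval partition serve all x ∈ X; the words on its blocks
    -- then form a Borel function of x, whose image absorbs the remaining dependence on x.
    additive∧bounded⇒SR𝓜 :
      (∀ f → BorelFunction (Subspace Cantor X) Cantor f → 𝓜-additive (Image f)) →
      (∀ f → BorelFunction (Subspace Cantor X) Baire f → Bounded (Image f)) → SR𝓜 X
    additive∧bounded⇒SR𝓜 additive bounded H (H-borel , H-meager) =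
      meager-⊆ covers (additive z z-borel F F-meager)
      where
      M : ModuloMeager H
      M = borel⇒moduloMeager H-borel

      -- Nothing is asked of `y` below `n`, so words chosen on different blocks can be concatenated
      -- without interference.
      Steers : ℕ → ℕ → 2^ω → Pred 2^ω 0ℓ
      Steers n N w x = ∀ j y → j ≤ n → w ≈⟨ n , N ⟩ y → x ∈ D M j N y

      steers-borel : ∀ n N w → Borel Cantor (Steers n N w)
      steers-borel n N w = borel-∀ ℕ↠ℕ λ j →
        borel-∀Seq ℕ↠Bool N {λ y x → j ≤ n → w ≈⟨ n , N ⟩ y → x ∈ D M j N y}
          (λ y≈y′ s j≤n w≈y′ → localᵇ (D-open M j) y≈y′
            (s j≤n λ i n≤i i<N → trans (w≈y′ i n≤i i<N) (sym (y≈y′ i i<N))))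
          λ y → borel-→ (borel-const (j ≤ n)) (borel-→ (borel-const _) (borel (D-open M j) N y))

      steers-local : ∀ {n N w w′} → Ball Cantor w N w′ → Steers n N w ⊆ Steers n N w′
      steers-local w≈w′ s j y j≤n w′≈y =
        s j y j≤n λ i n≤i i<N → trans (w≈w′ i i<N) (w′≈y i n≤i i<N)

      steers-grow : ∀ {n N N′ w} → N ≤ N′ → Steers n N w ⊆ Steers n N′ w
      steers-grow N≤N′ s j y j≤n w≈y = growᵇ-≤ (D-open M j) N≤N′
        (s j y j≤n λ i n≤i i<N → w≈y i n≤i (<-≤-trans i<N N≤N′))

      Steerable : ℕ → ℕ → Pred 2^ω 0ℓ
      Steerable n N x = ∃ λ w → Steers n N w x

      steerable : ∀ n x → ∃ λ N → Steerable n N x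
      steerable n x =
        let N , w , steered = steer n (⋂≤-denseOpen (λ j → D-denseOpen M j x) n)
        in N , w , λ j y j≤n w≈y → ⋂≤-elim (λ j n y → D M j n y x) j≤n (steered y w≈y)

      reach : Point (Subspace Cantor X) → ω^ω
      reach (x , _) n = μ (λ N → Steerable n N x)

      reach-borel : BorelFunction (Subspace Cantor X) Baire reach
      reach-borel = coordinatewise-borel ℕ↠ℕ λ n → borel-μ λ N →
        restriction-borel (borel-∃Seq ℕ↠Bool N steers-local (steers-borel n N))

      g : ω^ω
      g = proj₁ (bounded reach reach-borel)

      reach≤g : ∀ p → ∃ λ m → ∀ n → m ≤ n → reach p n ≤ g n
      reach≤g p = proj₂ (bounded reach reach-borel) (reach p) (p , λ _ → refl)

      -- Each block reaches at least to `g` of its left endpoint, so wherever `g` bounds `reach p`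
      -- it has room for a steering word.
      open Partition (λ _ b → g b)

      SteersBlock : ℕ → ℕ → Pred 2^ω 0ℓ
      SteersBlock k i = Steers (endpoint k) (endpoint (suc k)) (prefix ℕ↠Bool i)

      -- Selecting a code of a word as a least witness keeps the selection Borel; the default value
      -- can occur only on finitely many blocks for each `p`.
      choice : Point (Subspace Cantor X) → ℕ → ℕ
      choice (x , _) k = μ (λ i → SteersBlock k i x)

      choice-borel : ∀ k i → Borel (Subspace Cantor X) (λ p → choice p k ≡ i)
      choice-borel k = borel-μ λ i →
        restriction-borel (steers-borel (endpoint k) (endpoint (suc k)) (prefix ℕ↠Bool i))

      z : Point (Subspace Cantor X) → 2^ω
      z p = glue (λ k → prefix ℕ↠Bool (choice p k))

      z-borel : BorelFunction (Subspace Cantor X) Cantor z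
      z-borel = coordinatewise-borel ℕ↠Bool λ l a → resp-≐
        ( (λ { (_ , refl , q) → q }) , (λ q → _ , refl , q) )
        (borel-∃ ℕ↠ℕ λ i → borel-× (choice-borel (block l) i)
                                   (borel-const (prefix ℕ↠Bool i l ≡ a)))

      eventually-steers : ∀ p → ∃ λ m → ∀ k → m ≤ k → SteersBlock k (choice p k) (proj₁ p)
      eventually-steers p@(x , _) =
        let m , reach≤ = reach≤g p
        in m , λ k m≤k →
          let n      = endpoint k
              w , s  = proj₁ (μ-isLeast (steerable n x))
              N≤b′   = ≤-trans (reach≤ n (≤-trans m≤k (k≤endpoint k))) (h≤endpoint k)
              s′     = steers-grow N≤b′ s
              i , w≈ = prefix-dense ℕ↠Bool (endpoint (suc k)) w
          in proj₁ (μ-isLeast {λ i → SteersBlock k i x} (i , steers-local w≈ s′))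

      HitsFrom : ℕ → Pred 2^ω 0ℓ
      HitsFrom m y = ∀ k → m ≤ k → ∃ λ i → InBlock k i × y i ≡ true

      F : Pred 2^ω 0ℓ
      F y = ∃ λ m → y ∈ HitsFrom m

      F-meager : Meager Cantor F
      F-meager = HitsFrom
        , (λ m → hitting⇒nowhereDense {HitsFrom m} λ n → endpoint (suc (m + n)) , λ y∈ →
            let i , (b≤i , i<b′) , yi = y∈ (m + n) (m≤m+n m n)
            in i , ≤-trans (m≤n+m n m) (≤-trans (k≤endpoint (m + n)) b≤i) , i<b′ , yi)
        , id

      covers : (λ y → ∃ λ x → x ∈ X × y ∈ Section H x) ⊆ Image z ⊕ F
      covers {y} (x , x∈X , xy∈H) =
        -- From block `m` on, the chosen words steer; from block `j` on, they also handle the dense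
        -- open set `D M j` that `y` misses.
        z p , z p ⊞ y , (p , λ _ → refl) , (j + m , differs) , ⊞-cancel (z p) y
        where
        p : Point (Subspace Cantor X)
        p = x , x∈X

        miss = 𝓜-set-misses M (H-meager x) xy∈H
        j = proj₁ miss
        m = proj₁ (eventually-steers p)

        differs : ∀ k → j + m ≤ k → ∃ λ i → InBlock k i × (z p ⊞ y) i ≡ true
        -- If `z p ⊞ y` had no one in the block, `y` would agree there with the steering word and so
        -- enter the set it misses.
        differs k j+m≤k = ¬¬-elim λ same → proj₂ miss (endpoint (suc k))
          (proj₂ (eventually-steers p) k (≤-trans (m≤n+m m j) j+m≤k) j y
            (≤-trans (≤-trans (m≤m+n j m) j+m≤k) (k≤endpoint k))
            λ i b≤i i<b′ → trans (sym (glue-≡ (λ k → prefix ℕ↠Bool (choice p k)) {k} (b≤i , i<b′)))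
              (xor-false (¬-not λ xor≡true → same (i , (b≤i , i<b′) , xor≡true))))
          where
          xor-false : ∀ {a b} → a xor b ≡ false → a ≡ b
          xor-false {false} {false} _ = refl
          xor-false {true}  {true}  _ = refl

theorem2p3 : ExcludedMiddle (lsuc 0ℓ) → (X : Pred 2^ω 0ℓ) →
    SR𝓜 X ⇔
    ((∀ f → BorelFunction (Subspace Cantor X) Cantor f → 𝓜-additive (Image f)) ×
    (∀ f → BorelFunction (Subspace Cantor X) Baire f → Bounded (Image f)))
theorem2p3 em X = mk⇔
  (λ sr → SR𝓜⇒additive sr , SR𝓜⇒bounded sr)
  (λ (additive , bounded) → additive∧bounded⇒SR𝓜 additive bounded)
  where open Classical em
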